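{- For $k \geq 2$, \[ ex(n;C_{k+1};k) \leq \sum_{i=1}^{n} i^{1/k} = \frac{k}{k+1}n^{\frac{k+1}{k}} + O(n^{\frac{1}{k}}). \]
   Context: A digraph has a vertex set and an arc set consisting of ordered pairs of distinct vertices. A walk of length $\ell$ is a sequence $x_0x_1\dots x_\ell$ of vertices with $x_i \rightarrow x_{i+1}$ for all $i$. A digraph is $k$-geodetic if for every ordered pair $(u,v)$ of (not necessarily distinct) vertices there is at most one $u,v$-walk of length at most $k$. $C_{k+1}$ denotes the directed cycle of length $k+1$. For a digraph $Z$ and $k\ge 2$, $ex(n;Z;k)$ is the largest number of copies of $Z$ (subdigraphs isomorphic to $Z$) in a $k$-geodetic digraph with $n$ vertices. -}

module Defs where

open import Data.Nat as ℕ using (ℕ; zero; suc; _%_; _≤_)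
open import Data.Fin using (Fin; toℕ; zero; suc)
open import Data.Fin.Subset using (Subset; _∈_; _∉_)
open import Data.Vec using (Vec; lookup)
open import Data.List using (List; []; _∷_; length; head; last)
open import Data.Maybe using (just)
open import Data.Unit using (⊤)
open import Data.Product using (Σ; _×_; ∃; ∃-syntax)
open import Data.Rational using (ℚ; 1ℚ; 0ℚ; _*_; _+_)
open import Function using (Injective; _⇔_)
open import Relation.Binary.PropositionalEquality using (_≡_)

-- A digraph on the vertex set Fin n, given by the out-neighbourhood of
-- each vertex (a vector of subsets of Fin n).
Digraph : ℕ → Set
Digraph n = Vec (Subset n) n

Arc : ∀ {n} → Digraph n → Fin n → Fin n → Set
Arc G u v = v ∈ lookup G u

Loopless : ∀ {n} → Digraph n → Set
Loopless {n} G = ∀ (u : Fin n) → u ∉ lookup G u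

Chain : ∀ {n} → Digraph n → List (Fin n) → Set
Chain G [] = ⊤
Chain G (x ∷ []) = ⊤
Chain G (x ∷ y ∷ r) = Arc G x y × Chain G (y ∷ r)

-- w = x₀ x₁ … x_ℓ is a u,v-walk; its length is ℓ = length w − 1.
IsWalk : ∀ {n} → Digraph n → Fin n → Fin n → List (Fin n) → Set
IsWalk G u v w = (head w ≡ just u) × (last w ≡ just v) × Chain G w

-- k-geodetic: for all u, v (not necessarily distinct) there is at most one
-- u,v-walk of length at most k (i.e. with at most k+1 vertex entries).
KGeodetic : ∀ {n} → ℕ → Digraph n → Set
KGeodetic {n} k G =
  ∀ (u v : Fin n) (w₁ w₂ : List (Fin n)) →
  IsWalk G u v w₁ → IsWalk G u v w₂ →
  length w₁ ≤ suc k → length w₂ ≤ suc k → w₁ ≡ w₂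

SubDigraph : ℕ → Set
SubDigraph n = Subset n × Digraph n

IsSubdigraphOf : ∀ {n} → SubDigraph n → Digraph n → Set
IsSubdigraphOf {n} (S Data.Product., A) G =
  ∀ (u v : Fin n) → Arc A u v → Arc G u v × u ∈ S × v ∈ S

CycleArc : (k : ℕ) → Fin (suc k) → Fin (suc k) → Set
CycleArc k i j = toℕ j ≡ suc (toℕ i) % suc k

IsoToCycle : ∀ {n} → ℕ → SubDigraph n → Set
IsoToCycle {n} k (S Data.Product., A) =
  Σ (Fin (suc k) → Fin n) λ f →
    Injective _≡_ _≡_ f ×
    (∀ (x : Fin n) → (x ∈ S) ⇔ (∃[ i ] f i ≡ x)) ×
    (∀ (i j : Fin (suc k)) → Arc A (f i) (f j) ⇔ CycleArc k i j)

IsCopyOfCycle : ∀ {n} → ℕ → Digraph n → SubDigraph n → Set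
IsCopyOfCycle k G H = IsSubdigraphOf H G × IsoToCycle k H

powℚ : ℚ → ℕ → ℚ
powℚ q zero = 1ℚ
powℚ q (suc m) = q * powℚ q m

sumℚ : ∀ {n} → (Fin n → ℚ) → ℚ
sumℚ {zero} f = 0ℚ
sumℚ {suc n} f = f zero + sumℚ (λ i → f (suc i))

{-# OPTIONS --safe #-}
module Submission where

-- Two copies of C_{k+1} sharing an arc u → w coincide: each contains a w,u-walk of
-- length k, and in a k-geodetic digraph these walks are equal.  So a vertex lying on
-- δ copies has δ distinct out-neighbours along them.  Let v lie on the fewest copies,
-- δ say, among m remaining vertices.  Walking k steps along such out-neighbours
-- reaches δ^k distinct vertices, all different from v, so δ^k < m ≤ q_{m-1}^k and
-- δ ≤ q_{m-1}.  Delete v and the copies through it, and induct on m.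

open import Defs
open import Data.Nat using (ℕ; _≤_; suc)
open import Data.Fin using (Fin; toℕ)
open import Data.List using (List; length)
open import Data.List.Relation.Unary.All using (All)
open import Data.List.Relation.Unary.Unique.Propositional using (Unique)
open import Data.Product using (_×_)
open import Data.Integer using (+_)
open import Data.Rational using (ℚ; 0ℚ; _/_)
open import Data.Rational using () renaming (_≤_ to _≤ℚ_)

open import Data.Nat using (zero; _+_; _*_; _^_; _<_; _%_; NonZero; z≤n; s≤s; z<s; s<s)
open import Data.Nat.Properties
  using (≤-refl; ≤-trans; ≤-pred; ≤-reflexive; <⇒≢; <⇒≱; suc-injective; +-comm; +-suc)
open import Data.Nat.DivMod
  using (_mod_; %-distribˡ-+; m%n%n≡m%n; [m+n]%n≡m%n; [m+kn]%n≡m%n; m<n⇒m%n≡m; m%n<n)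
open import Data.Nat.Tactic.RingSolver using (solve-∀)
import Data.Integer as ℤ
import Data.Integer.Properties as ℤ
import Data.Nat.Coprimality as Coprimality
import Data.Rational as ℚ
import Data.Rational.Properties as ℚ
open import Data.Fin as Fin using (inject₁; inject≤; fromℕ; finToFun; funToFin; combine; _≟_)
open import Data.Fin.Properties
  using (toℕ-injective; toℕ-fromℕ<; toℕ<n; toℕ-inject₁; toℕ-fromℕ; inject≤-injective;
         funToFin-finToFin; injective⇒≤)
open import Data.Fin.Subset using (_∈_; _⊆_; Nonempty)
open import Data.Fin.Subset.Properties using (_∈?_; ⊆-antisym; nonempty?)
open import Data.Vec using (lookup; tabulate)
open import Data.Vec.Properties using (tabulate∘lookup; tabulate-cong)
import Data.List as List
open import Data.List using ([]; _∷_; filter; applyUpTo; allFin)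
open import Data.List.Properties using (length-applyUpTo; ∷-injective; filter-notAll; length-tabulate)
open import Data.List.Extrema.Nat using (argmin; argmin-all; f[argmin]≤f[⊤]; f[argmin]≤f[xs])
open import Data.List.Membership.Propositional using () renaming (_∈_ to _∈ₗ_)
open import Data.List.Membership.Propositional.Properties using (∈-lookup; ∈-filter⁺; ∈-allFin)
open import Data.List.Relation.Unary.All using ([]; _∷_)
import Data.List.Relation.Unary.All as All
import Data.List.Relation.Unary.All.Properties as All
open import Data.List.Relation.Unary.AllPairs using (_∷_)
import Data.List.Relation.Unary.AllPairs.Properties as AllPairs
open import Data.List.Relation.Unary.Any using (here; there; index)
import Data.List.Relation.Unary.Any as Any
open import Data.List.Relation.Unary.Any.Properties using (lookup-index)
open import Data.Maybe using (just)
open import Data.Unit using (tt)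
open import Data.Product using (Σ; _,_; proj₁; proj₂; ∃-syntax)
open import Data.Sum using (inj₁; inj₂)
open import Function using (_∘_; _⇔_; Injective; Equivalence)
open import Relation.Binary.PropositionalEquality
open import Relation.Nullary using (yes; no; ¬?; contradiction)
open import Relation.Unary using (Decidable)
open import Relation.Unary.Properties using (∁?)

open Equivalence using (to; from)

ι : ℕ → ℚ
ι a = + a / 1

-- The normal form of a / 1, on which ℚ's _+_ and _*_ compute.
ι≡mkℚ : ∀ a → ι a ≡ ℚ.mkℚ (+ a) 0 (Coprimality.sym (Coprimality.1-coprimeTo a))
ι≡mkℚ a = ℚ.normalize-coprime _

ι-+ : ∀ a b → ι (a + b) ≡ ι a ℚ.+ ι b
ι-+ a b = sym (begin
  ι a ℚ.+ ι b                        ≡⟨ cong₂ ℚ._+_ (ι≡mkℚ a) (ι≡mkℚ b) ⟩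
  (+ a ℤ.* + 1 ℤ.+ + b ℤ.* + 1) / 1  ≡⟨ cong₂ (λ x y → (x ℤ.+ y) / 1)
                                          (ℤ.*-identityʳ (+ a)) (ℤ.*-identityʳ (+ b)) ⟩
  ι (a + b)                          ∎)
  where open ≡-Reasoning

ι-* : ∀ a b → ι (a * b) ≡ ι a ℚ.* ι b
ι-* a b = sym (begin
  ι a ℚ.* ι b        ≡⟨ cong₂ ℚ._*_ (ι≡mkℚ a) (ι≡mkℚ b) ⟩
  (+ a ℤ.* + b) / 1  ≡⟨ cong (_/ 1) (ℤ.pos-* a b) ⟨
  ι (a * b)          ∎)
  where open ≡-Reasoning

ι-^ : ∀ a k → powℚ (ι a) k ≡ ι (a ^ k)
ι-^ a zero = refl
ι-^ a (suc k) = trans (cong (ι a ℚ.*_) (ι-^ a k)) (sym (ι-* a (a ^ k)))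

ι-mono-≤ : ∀ {a b} → a ≤ b → ι a ≤ℚ ι b
ι-mono-≤ {a} {b} a≤b rewrite ι≡mkℚ a | ι≡mkℚ b =
  ℚ.*≤* (subst₂ ℤ._≤_ (sym (ℤ.*-identityʳ (+ a))) (sym (ℤ.*-identityʳ (+ b))) (ℤ.+≤+ a≤b))

ι-cancel-≤ : ∀ {a b} → ι a ≤ℚ ι b → a ≤ b
ι-cancel-≤ {a} {b} ιa≤ιb rewrite ι≡mkℚ a | ι≡mkℚ b =
  ℤ.drop‿+≤+ (subst₂ ℤ._≤_ (ℤ.*-identityʳ (+ a)) (ℤ.*-identityʳ (+ b)) (ℚ.drop-*≤* ιa≤ιb))

powℚ-nonNeg : ∀ k {p} → 0ℚ ≤ℚ p → 0ℚ ≤ℚ powℚ p k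
powℚ-nonNeg zero _ = ι-mono-≤ {0} {1} z≤n
powℚ-nonNeg (suc k) {p} 0≤p = ℚ.nonNegative⁻¹ _
  {{ℚ.nonNeg*nonNeg⇒nonNeg p {{ℚ.nonNegative 0≤p}} (powℚ p k) {{ℚ.nonNegative (powℚ-nonNeg k 0≤p)}}}}

powℚ-mono-≤ : ∀ k {p q} → 0ℚ ≤ℚ p → p ≤ℚ q → powℚ p k ≤ℚ powℚ q k
powℚ-mono-≤ zero _ _ = ℚ.≤-refl
powℚ-mono-≤ (suc k) {p} {q} 0≤p p≤q = ℚ.≤-trans
  (ℚ.*-monoʳ-≤-nonNeg (powℚ p k) {{ℚ.nonNegative (powℚ-nonNeg k 0≤p)}} p≤q)
  (ℚ.*-monoˡ-≤-nonNeg q {{ℚ.nonNegative (ℚ.≤-trans 0≤p p≤q)}} (powℚ-mono-≤ k 0≤p p≤q))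

≤-kth-root : ∀ k {δ m q} → 0ℚ ≤ℚ q → ι m ≤ℚ powℚ q k → δ ^ k < m → ι δ ≤ℚ q
≤-kth-root k {δ} {m} {q} 0≤q m≤qᵏ δᵏ<m with ℚ.≤-total q (ι δ)
... | inj₂ ιδ≤q = ιδ≤q
... | inj₁ q≤ιδ = contradiction (ι-cancel-≤ m≤δᵏ) (<⇒≱ δᵏ<m)
  where
    m≤δᵏ : ι m ≤ℚ ι (δ ^ k)
    m≤δᵏ = ℚ.≤-trans m≤qᵏ (subst (powℚ q k ≤ℚ_) (ι-^ δ k) (powℚ-mono-≤ k 0≤q q≤ιδ))

RootBounds : ∀ {m} → ℕ → (Fin m → ℚ) → Set
RootBounds k q = ∀ i → 0ℚ ≤ℚ q i × ι (suc (toℕ i)) ≤ℚ powℚ (q i) k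

RootBounds-init : ∀ {k m} {q : Fin (suc m) → ℚ} → RootBounds k q → RootBounds k (q ∘ inject₁)
RootBounds-init {k} {q = q} bounds i =
  subst (λ t → 0ℚ ≤ℚ q (inject₁ i) × ι (suc t) ≤ℚ powℚ (q (inject₁ i)) k)
        (toℕ-inject₁ i) (bounds (inject₁ i))

RootBounds-last : ∀ {k m} {q : Fin (suc m) → ℚ} → RootBounds k q →
  0ℚ ≤ℚ q (fromℕ m) × ι (suc m) ≤ℚ powℚ (q (fromℕ m)) k
RootBounds-last {k} {m} {q} bounds =
  subst (λ t → 0ℚ ≤ℚ q (fromℕ m) × ι (suc t) ≤ℚ powℚ (q (fromℕ m)) k)
        (toℕ-fromℕ m) (bounds (fromℕ m))

sumℚ-nonNeg : ∀ {m} (f : Fin m → ℚ) → (∀ i → 0ℚ ≤ℚ f i) → 0ℚ ≤ℚ sumℚ f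
sumℚ-nonNeg {zero} f _ = ℚ.≤-refl
sumℚ-nonNeg {suc m} f 0≤f = ℚ.+-mono-≤ (0≤f Fin.zero) (sumℚ-nonNeg (f ∘ Fin.suc) (0≤f ∘ Fin.suc))

sumℚ-init-last : ∀ {m} (f : Fin (suc m) → ℚ) → sumℚ f ≡ sumℚ (f ∘ inject₁) ℚ.+ f (fromℕ m)
sumℚ-init-last {zero} f = trans (ℚ.+-identityʳ (f Fin.zero)) (sym (ℚ.+-identityˡ (f Fin.zero)))
sumℚ-init-last {suc m} f = trans (cong (f Fin.zero ℚ.+_) (sumℚ-init-last (f ∘ Fin.suc)))
  (sym (ℚ.+-assoc (f Fin.zero) (sumℚ (f ∘ Fin.suc ∘ inject₁)) (f (fromℕ (suc m)))))

length-filter-∁ : ∀ {A : Set} {P : A → Set} (P? : Decidable P) xs →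
  length xs ≡ length (filter P? xs) + length (filter (∁? P?) xs)
length-filter-∁ P? [] = refl
length-filter-∁ P? (x ∷ xs) with P? x
... | yes _ = cong suc (length-filter-∁ P? xs)
... | no _ = trans (cong suc (length-filter-∁ P? xs)) (sym (+-suc _ _))

lookup-injective : ∀ {A : Set} {xs : List A} → Unique xs → Injective _≡_ _≡_ (List.lookup xs)
lookup-injective {xs = _ ∷ _} _ {Fin.zero} {Fin.zero} _ = refl
lookup-injective {xs = _ ∷ _} (x∉xs ∷ _) {Fin.zero} {Fin.suc j} eq =
  contradiction eq (All.lookup x∉xs (∈-lookup j))
lookup-injective {xs = _ ∷ _} (x∉xs ∷ _) {Fin.suc i} {Fin.zero} eq =
  contradiction (sym eq) (All.lookup x∉xs (∈-lookup i))
lookup-injective {xs = _ ∷ _} (_ ∷ uniq) {Fin.suc i} {Fin.suc j} eq =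
  cong Fin.suc (lookup-injective uniq eq)

minimiser : ∀ {A : Set} (f : A → ℕ) x xs →
  ∃[ v ] v ∈ₗ x ∷ xs × (∀ {u} → u ∈ₗ x ∷ xs → f v ≤ f u)
minimiser f x xs = argmin f x xs , argmin-all f (here refl) (All.tabulate there) , λ where
  (here refl) → f[argmin]≤f[⊤] {f = f} x xs
  (there u∈xs) → All.lookup (f[argmin]≤f[xs] {f = f} x xs) u∈xs

funToFin-cong : ∀ {t m} {f g : Fin t → Fin m} → (∀ i → f i ≡ g i) → funToFin f ≡ funToFin g
funToFin-cong {zero} _ = refl
funToFin-cong {suc t} f≗g = cong₂ combine (f≗g Fin.zero) (funToFin-cong (f≗g ∘ Fin.suc))

finToFun-injective : ∀ {m t} {a b : Fin (m ^ t)} → (∀ i → finToFun a i ≡ finToFun b i) → a ≡ b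
finToFun-injective {m} {t} {a} {b} a≗b = begin
  a                             ≡⟨ funToFin-finToFin {t} {m} a ⟨
  funToFin (finToFun {m} {t} a) ≡⟨ funToFin-cong {t} {m} a≗b ⟩
  funToFin (finToFun {m} {t} b) ≡⟨ funToFin-finToFin {t} {m} b ⟩
  b                             ∎
  where open ≡-Reasoning

-- Walks in k-geodetic digraphs

IsPath : ∀ {n} → Digraph n → (ℕ → Fin n) → ℕ → Set
IsPath G f ℓ = ∀ i → i < ℓ → Arc G (f i) (f (suc i))

applyUpTo-injective : ∀ {A : Set} {f g : ℕ → A} ℓ →
  applyUpTo f ℓ ≡ applyUpTo g ℓ → ∀ i → i < ℓ → f i ≡ g i
applyUpTo-injective (suc ℓ) eq zero _ = proj₁ (∷-injective eq)
applyUpTo-injective (suc ℓ) eq (suc i) (s<s i<ℓ) = applyUpTo-injective ℓ (proj₂ (∷-injective eq)) i i<ℓ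

module _ {n : ℕ} {G : Digraph n} where

  applyUpTo-chain : ∀ {f ℓ} → IsPath G f ℓ → Chain G (applyUpTo f (suc ℓ))
  applyUpTo-chain {ℓ = zero} _ = tt
  applyUpTo-chain {ℓ = suc ℓ} path = path 0 z<s , applyUpTo-chain (λ i i<ℓ → path (suc i) (s<s i<ℓ))

  applyUpTo-last : ∀ (f : ℕ → Fin n) ℓ → List.last (applyUpTo f (suc ℓ)) ≡ just (f ℓ)
  applyUpTo-last f zero = refl
  applyUpTo-last f (suc ℓ) = applyUpTo-last (f ∘ suc) ℓ

  path⇒walk : ∀ {f ℓ} → IsPath G f ℓ → IsWalk G (f 0) (f ℓ) (applyUpTo f (suc ℓ))
  path⇒walk {f} {ℓ} path = refl , applyUpTo-last f ℓ , applyUpTo-chain path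

  module _ {k : ℕ} (geo : KGeodetic k G) where

    geodetic-path-unique : ∀ {f g ℓ ℓ′} → IsPath G f ℓ → IsPath G g ℓ′ → ℓ ≤ k → ℓ′ ≤ k →
      f 0 ≡ g 0 → f ℓ ≡ g ℓ′ → applyUpTo f (suc ℓ) ≡ applyUpTo g (suc ℓ′)
    geodetic-path-unique {f} {g} {ℓ} {ℓ′} pf pg ℓ≤k ℓ′≤k start end =
      geo (f 0) (f ℓ) _ _ (path⇒walk pf)
        (subst₂ (λ u v → IsWalk G u v (applyUpTo g (suc ℓ′))) (sym start) (sym end) (path⇒walk pg))
        (walk-length f ℓ≤k) (walk-length g ℓ′≤k)
      where
        walk-length : ∀ h {ℓ} → ℓ ≤ k → length (applyUpTo h (suc ℓ)) ≤ suc k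
        walk-length h {ℓ} ℓ≤k = subst (_≤ suc k) (sym (length-applyUpTo h (suc ℓ))) (s≤s ℓ≤k)

    geodetic-paths-agree : ∀ {f g ℓ} → IsPath G f ℓ → IsPath G g ℓ → ℓ ≤ k →
      f 0 ≡ g 0 → f ℓ ≡ g ℓ → ∀ i → i ≤ ℓ → f i ≡ g i
    geodetic-paths-agree {f} {g} {ℓ} pf pg ℓ≤k start end i i≤ℓ =
      applyUpTo-injective {f = f} {g} (suc ℓ) (geodetic-path-unique {f} {g} pf pg ℓ≤k ℓ≤k start end) i (s≤s i≤ℓ)

    geodetic-no-short-cycle : ∀ {f ℓ} → 1 ≤ ℓ → ℓ ≤ k → IsPath G f ℓ → f ℓ ≢ f 0
    geodetic-no-short-cycle {f} {ℓ} 1≤ℓ ℓ≤k path closed = <⇒≢ 1≤ℓ (sym (suc-injective lengths))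
      where
        stay : IsPath G (λ _ → f 0) 0
        stay _ ()
        lengths : suc ℓ ≡ 1
        lengths = trans (sym (length-applyUpTo f (suc ℓ)))
          (cong length (geodetic-path-unique path stay ℓ≤k z≤n refl closed))

module Moore {n : ℕ} {G : Digraph n} {k : ℕ} (geo : KGeodetic k G) {m δ : ℕ}
             (V : Fin m → Fin n) (next : Fin m → Fin δ → Fin m)
             (next-arc : ∀ p i → Arc G (V p) (V (next p i)))
             (next-injective : ∀ p → Injective _≡_ _≡_ (V ∘ next p)) where

  follow : ∀ {t} → Fin m → (Fin t → Fin δ) → ℕ → Fin m
  follow p ds zero = p
  follow {zero} p ds (suc i) = p
  follow {suc t} p ds (suc i) = follow (next p (ds Fin.zero)) (ds ∘ Fin.suc) i

  follow-path : ∀ {t} p (ds : Fin t → Fin δ) → IsPath G (V ∘ follow p ds) t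
  follow-path {suc t} p ds zero _ = next-arc p (ds Fin.zero)
  follow-path {suc t} p ds (suc i) (s<s i<t) = follow-path (next p (ds Fin.zero)) (ds ∘ Fin.suc) i i<t

  follow-injective : ∀ {t} p (ds es : Fin t → Fin δ) →
    (∀ i → i ≤ t → V (follow p ds i) ≡ V (follow p es i)) → ∀ j → ds j ≡ es j
  follow-injective {suc t} p ds es agree = λ where
      Fin.zero → first
      (Fin.suc j) → follow-injective (next p (ds Fin.zero)) (ds ∘ Fin.suc) (es ∘ Fin.suc) agree-rest j
    where
      first : ds Fin.zero ≡ es Fin.zero
      first = next-injective p (agree 1 (s≤s z≤n))
      agree-rest : ∀ i → i ≤ t → V (follow (next p (ds Fin.zero)) (ds ∘ Fin.suc) i)
                                 ≡ V (follow (next p (ds Fin.zero)) (es ∘ Fin.suc) i)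
      agree-rest i i≤t = trans (agree (suc i) (s≤s i≤t))
        (cong (λ d → V (follow (next p d) (es ∘ Fin.suc) i)) (sym first))

  moore-bound : 1 ≤ k → Fin m → suc (δ ^ k) ≤ m
  moore-bound k≥1 p = injective⇒≤ {f = ends} (λ {a} {b} eq → ends-injective a b (cong V eq))
    where
      end : Fin (δ ^ k) → Fin m
      end c = follow p (finToFun c) k
      ends : Fin (suc (δ ^ k)) → Fin m
      ends Fin.zero = p
      ends (Fin.suc c) = end c
      end≢start : ∀ c → V (end c) ≢ V p
      end≢start c = geodetic-no-short-cycle geo k≥1 ≤-refl (follow-path p (finToFun c))
      ends-injective : ∀ a b → V (ends a) ≡ V (ends b) → a ≡ b
      ends-injective Fin.zero Fin.zero _ = refl
      ends-injective Fin.zero (Fin.suc c) eq = contradiction (sym eq) (end≢start c)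
      ends-injective (Fin.suc c) Fin.zero eq = contradiction eq (end≢start c)
      ends-injective (Fin.suc c) (Fin.suc c′) eq = cong Fin.suc (finToFun-injective
        (follow-injective p _ _ (geodetic-paths-agree geo (follow-path p _) (follow-path p _) ≤-refl refl eq)))

-- Copies of C_{k+1}

%-absorbʳ : ∀ m n d .{{_ : NonZero d}} → (m + n % d) % d ≡ (m + n) % d
%-absorbʳ m n d = begin
  (m + n % d) % d          ≡⟨ %-distribˡ-+ m (n % d) d ⟩
  (m % d + n % d % d) % d  ≡⟨ cong (λ r → (m % d + r) % d) (m%n%n≡m%n n d) ⟩
  (m % d + n % d) % d      ≡⟨ %-distribˡ-+ m n d ⟨
  (m + n) % d              ∎
  where open ≡-Reasoning

module CycleCopy {n k : ℕ} {G : Digraph n} (H : SubDigraph n) (c : IsCopyOfCycle k G H) where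

  private
    f : Fin (suc k) → Fin n
    f = proj₁ (proj₂ c)

    image : ∀ x → (x ∈ proj₁ H) ⇔ (∃[ i ] f i ≡ x)
    image = proj₁ (proj₂ (proj₂ (proj₂ c)))

    f-arc : ∀ i j → Arc (proj₂ H) (f i) (f j) ⇔ CycleArc k i j
    f-arc = proj₂ (proj₂ (proj₂ (proj₂ c)))

    mod≡⇒f≡ : ∀ p {i : Fin (suc k)} → p % suc k ≡ toℕ i → f (p mod suc k) ≡ f i
    mod≡⇒f≡ p eq = cong f (toℕ-injective (trans (toℕ-fromℕ< _) eq))

  cyc : ℕ → Fin n
  cyc p = f (p mod suc k)

  cyc-cong : ∀ p q → p % suc k ≡ q % suc k → cyc p ≡ cyc q
  cyc-cong p q eq = mod≡⇒f≡ p (trans eq (sym (toℕ-fromℕ< (m%n<n q (suc k)))))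

  cyc-toℕ : ∀ i → cyc (toℕ i) ≡ f i
  cyc-toℕ i = mod≡⇒f≡ (toℕ i) (m<n⇒m%n≡m (toℕ<n i))

  cyc-arc : ∀ p → Arc (proj₂ H) (cyc p) (cyc (suc p))
  cyc-arc p = from (f-arc (p mod suc k) (suc p mod suc k)) (begin
    toℕ (suc p mod suc k)            ≡⟨ toℕ-fromℕ< _ ⟩
    suc p % suc k                    ≡⟨ %-absorbʳ 1 p (suc k) ⟨
    suc (p % suc k) % suc k          ≡⟨ cong (λ r → suc r % suc k) (toℕ-fromℕ< _) ⟨
    suc (toℕ (p mod suc k)) % suc k  ∎)
    where open ≡-Reasoning

  cyc-∈ : ∀ p → cyc p ∈ proj₁ H
  cyc-∈ p = from (image (cyc p)) (p mod suc k , refl)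

  ∈⇒cyc : ∀ {w} → w ∈ proj₁ H → ∃[ p ] w ≡ cyc p
  ∈⇒cyc {w} w∈H with to (image w) w∈H
  ... | i , refl = toℕ i , sym (cyc-toℕ i)

  arc⇒cyc : ∀ {u w} → Arc (proj₂ H) u w → ∃[ p ] u ≡ cyc p × w ≡ cyc (suc p)
  arc⇒cyc {u} {w} u→w with proj₁ c u w u→w
  ... | _ , u∈H , w∈H with to (image u) u∈H | to (image w) w∈H
  ... | i , refl | j , refl =
    toℕ i , sym (cyc-toℕ i) , sym (mod≡⇒f≡ (suc (toℕ i)) (sym (to (f-arc i j) u→w)))

  cyc-closes : ∀ p → cyc (k + suc p) ≡ cyc p
  cyc-closes p = cyc-cong (k + suc p) p
    (trans (cong (_% suc k) (trans (+-comm k (suc p)) (sym (+-suc p k)))) ([m+n]%n≡m%n p (suc k)))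

  cyc-rotate : ∀ a p → cyc (p + k * a + a) ≡ cyc p
  cyc-rotate a p = cyc-cong (p + k * a + a) p (trans (cong (_% suc k) (rearrange p k a)) ([m+kn]%n≡m%n p a (suc k)))
    where
      rearrange : ∀ p k a → p + k * a + a ≡ p + a * suc k
      rearrange = solve-∀

  cyc-path : ∀ a ℓ → IsPath G (λ r → cyc (r + a)) ℓ
  cyc-path a ℓ r _ = proj₁ (proj₁ c _ _ (cyc-arc (r + a)))

  out-arc : ∀ {u} → u ∈ proj₁ H → Nonempty (lookup (proj₂ H) u)
  out-arc u∈H with ∈⇒cyc u∈H
  ... | p , refl = cyc (suc p) , cyc-arc p

module _ {n : ℕ} where

  _⊑_ : SubDigraph n → SubDigraph n → Set
  (S , A) ⊑ (S′ , A′) = S ⊆ S′ × (∀ u → lookup A u ⊆ lookup A′ u)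

  ⊑-antisym : ∀ {H H′} → H ⊑ H′ → H′ ⊑ H → H ≡ H′
  ⊑-antisym {S , A} {S′ , A′} (S⊆S′ , A⊆A′) (S′⊆S , A′⊆A) =
    cong₂ _,_ (⊆-antisym S⊆S′ S′⊆S) (begin
      A                    ≡⟨ tabulate∘lookup A ⟨
      tabulate (lookup A)  ≡⟨ tabulate-cong (λ u → ⊆-antisym (A⊆A′ u) (A′⊆A u)) ⟩
      tabulate (lookup A′) ≡⟨ tabulate∘lookup A′ ⟩
      A′                   ∎)
    where open ≡-Reasoning

module _ {n k : ℕ} {G : Digraph n} where

  shift-⊑ : ∀ {H H′} (c : IsCopyOfCycle k G H) (c′ : IsCopyOfCycle k G H′) {a b} →
    (∀ r → CycleCopy.cyc {G = G} H c (r + a) ≡ CycleCopy.cyc {G = G} H′ c′ (r + b)) → H ⊑ H′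
  shift-⊑ {H} {H′} c c′ {a} {b} agree = vertices , arcs
    where
      module C = CycleCopy {G = G} H c
      module C′ = CycleCopy {G = G} H′ c′
      moved : ∀ p → C.cyc p ≡ C′.cyc (p + k * a + b)
      moved p = trans (sym (C.cyc-rotate a p)) (agree (p + k * a))
      vertices : proj₁ H ⊆ proj₁ H′
      vertices w∈H with C.∈⇒cyc w∈H
      ... | p , refl = subst (_∈ proj₁ H′) (sym (moved p)) (C′.cyc-∈ (p + k * a + b))
      arcs : ∀ u → lookup (proj₂ H) u ⊆ lookup (proj₂ H′) u
      arcs u u→w with C.arc⇒cyc u→w
      ... | p , refl , refl =
        subst₂ (Arc (proj₂ H′)) (sym (moved p)) (sym (moved (suc p))) (C′.cyc-arc (p + k * a + b))

  copies-sharing-arc-coincide : KGeodetic k G → ∀ {H H′ u w} →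
    IsCopyOfCycle k G H → IsCopyOfCycle k G H′ → Arc (proj₂ H) u w → Arc (proj₂ H′) u w → H ≡ H′
  copies-sharing-arc-coincide geo {H} {H′} c c′ u→w u→w′
    with CycleCopy.arc⇒cyc {G = G} H c u→w | CycleCopy.arc⇒cyc {G = G} H′ c′ u→w′
  ... | i , u≡ , w≡ | j , u≡′ , w≡′ =
    ⊑-antisym (shift-⊑ {H} {H′} c c′ {suc i} {suc j} agree)
              (shift-⊑ {H′} {H} c′ c {suc j} {suc i} (sym ∘ agree))
    where
      module C = CycleCopy {G = G} H c
      module C′ = CycleCopy {G = G} H′ c′
      agree-≤k : ∀ r → r ≤ k → C.cyc (r + suc i) ≡ C′.cyc (r + suc j)
      agree-≤k = geodetic-paths-agree geo (C.cyc-path (suc i) k) (C′.cyc-path (suc j) k) ≤-refl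
        (trans (sym w≡) w≡′)
        (trans (C.cyc-closes i) (trans (sym u≡) (trans u≡′ (sym (C′.cyc-closes j)))))
      agree : ∀ r → C.cyc (r + suc i) ≡ C′.cyc (r + suc j)
      agree r = begin
        C.cyc (r + suc i)           ≡⟨ C.cyc-cong (r % suc k + suc i) (r + suc i) (reduce (suc i)) ⟨
        C.cyc (r % suc k + suc i)   ≡⟨ agree-≤k (r % suc k) (≤-pred (m%n<n r (suc k))) ⟩
        C′.cyc (r % suc k + suc j)  ≡⟨ C′.cyc-cong (r % suc k + suc j) (r + suc j) (reduce (suc j)) ⟩
        C′.cyc (r + suc j)          ∎
        where
          open ≡-Reasoning
          reduce : ∀ a → (r % suc k + a) % suc k ≡ (r + a) % suc k
          reduce a = begin
            (r % suc k + a) % suc k  ≡⟨ cong (_% suc k) (+-comm (r % suc k) a) ⟩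
            (a + r % suc k) % suc k  ≡⟨ %-absorbʳ a r (suc k) ⟩
            (a + r) % suc k          ≡⟨ cong (_% suc k) (+-comm a r) ⟩
            (r + a) % suc k          ∎

-- Counting copies

successor : ∀ {n} → SubDigraph n → Fin n → Fin n
successor (_ , A) u with nonempty? (lookup A u)
... | yes (w , _) = w
... | no _ = u

through : ∀ {n} → Fin n → List (SubDigraph n) → List (SubDigraph n)
through u = filter (λ H → u ∈? proj₁ H)

avoiding : ∀ {n} → Fin n → List (SubDigraph n) → List (SubDigraph n)
avoiding u = filter (∁? (λ H → u ∈? proj₁ H))

degree : ∀ {n} → Fin n → List (SubDigraph n) → ℕ
degree u L = length (through u L)

Within : ∀ {n} → List (Fin n) → SubDigraph n → Set
Within V H = ∀ w → w ∈ proj₁ H → w ∈ₗ V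

remove : ∀ {n} → Fin n → List (Fin n) → List (Fin n)
remove v = filter (λ u → ¬? (u ≟ v))

length-remove : ∀ {n} {v : Fin n} {V} → v ∈ₗ V → length (remove v V) < length V
length-remove {v = v} {V} v∈V =
  filter-notAll (λ u → ¬? (u ≟ v)) V (Any.map (λ v≡u u≢v → u≢v (sym v≡u)) v∈V)

avoiding-within-remove : ∀ {n} (v : Fin n) {V} L → All (Within V) L → All (Within (remove v V)) (avoiding v L)
avoiding-within-remove v {V} L within = All.zipWith
  (λ {H} (v∉H , H⊆V) w w∈H → ∈-filter⁺ (λ u → ¬? (u ≟ v)) (H⊆V w w∈H) (λ { refl → v∉H w∈H }))
  (All.all-filter (∁? (λ H → v ∈? proj₁ H)) L , All.filter⁺ _ within)

module _ {n k : ℕ} {G : Digraph n} (geo : KGeodetic k G) where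

  successor-arc : ∀ {H u} → IsCopyOfCycle k G H → u ∈ proj₁ H → Arc (proj₂ H) u (successor H u)
  successor-arc {S , A} {u} c u∈H with nonempty? (lookup A u)
  ... | yes (_ , u→w) = u→w
  ... | no ∄w = contradiction (CycleCopy.out-arc {G = G} (S , A) c u∈H) ∄w

  successor-injective : ∀ {u T} → Unique T → All (IsCopyOfCycle k G) T → All (λ H → u ∈ proj₁ H) T →
    Injective _≡_ _≡_ (λ i → successor (List.lookup T i) u)
  successor-injective {u} {T} uniq copies on-u {i} {j} same = lookup-injective uniq
    (copies-sharing-arc-coincide geo (copy i) (copy j) (successor-arc (copy i) (on i))
      (subst (Arc (proj₂ (List.lookup T j)) u) (sym same) (successor-arc (copy j) (on j))))
    where
      copy : ∀ i → IsCopyOfCycle k G (List.lookup T i)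
      copy i = All.lookup copies (∈-lookup i)
      on : ∀ i → u ∈ proj₁ (List.lookup T i)
      on i = All.lookup on-u (∈-lookup i)

  copy-neighbours : ∀ {L V u δ} → Unique L → All (IsCopyOfCycle k G) L → All (Within V) L → δ ≤ degree u L →
    Σ (Fin δ → Fin (length V)) λ nb →
      (∀ i → Arc G u (List.lookup V (nb i))) × Injective _≡_ _≡_ (List.lookup V ∘ nb)
  copy-neighbours {L} {V} {u} {δ} uniq copies within δ≤deg = index ∘ succ∈V , arc , injective
    where
      on-u : All (λ H → u ∈ proj₁ H) (through u L)
      on-u = All.all-filter (λ H → u ∈? proj₁ H) L
      cycle : Fin δ → SubDigraph n
      cycle i = List.lookup (through u L) (inject≤ i δ≤deg)
      copy : ∀ i → IsCopyOfCycle k G (cycle i)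
      copy i = All.lookup (All.filter⁺ _ copies) (∈-lookup _)
      out : ∀ i → Arc (proj₂ (cycle i)) u (successor (cycle i) u)
      out i = successor-arc (copy i) (All.lookup on-u (∈-lookup _))
      succ∈V : ∀ i → successor (cycle i) u ∈ₗ V
      succ∈V i = All.lookup (All.filter⁺ _ within) (∈-lookup _) _ (proj₂ (proj₂ (proj₁ (copy i) _ _ (out i))))
      lookup-succ : ∀ i → List.lookup V (index (succ∈V i)) ≡ successor (cycle i) u
      lookup-succ i = sym (lookup-index (succ∈V i))
      arc : ∀ i → Arc G u (List.lookup V (index (succ∈V i)))
      arc i = subst (Arc G u) (sym (lookup-succ i)) (proj₁ (proj₁ (copy i) _ _ (out i)))
      injective : Injective _≡_ _≡_ (List.lookup V ∘ index ∘ succ∈V)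
      injective {i} {j} eq = inject≤-injective _ _ i j
        (successor-injective (AllPairs.filter⁺ _ uniq) (All.filter⁺ _ copies) on-u
          (trans (sym (lookup-succ i)) (trans eq (lookup-succ j))))

  min-degree-bound : 1 ≤ k → ∀ {L V δ v} → Unique L → All (IsCopyOfCycle k G) L → All (Within V) L →
    (∀ {u} → u ∈ₗ V → δ ≤ degree u L) → v ∈ₗ V → suc (δ ^ k) ≤ length V
  min-degree-bound k≥1 {V = V} uniq copies within min-deg v∈V =
    Moore.moore-bound geo (List.lookup V) (proj₁ ∘ neighbours) (proj₁ ∘ proj₂ ∘ neighbours)
      (proj₂ ∘ proj₂ ∘ neighbours) k≥1 (index v∈V)
    where
      neighbours = λ p → copy-neighbours uniq copies within (min-deg (∈-lookup p))

  copies-bound : 1 ≤ k → ∀ m (q : Fin m → ℚ) → RootBounds k q → ∀ V → length V ≤ m →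
    ∀ L → Unique L → All (IsCopyOfCycle k G) L → All (Within V) L → ι (length L) ≤ℚ sumℚ q
  copies-bound _ m q bounds [] _ [] _ _ _ = sumℚ-nonNeg q (proj₁ ∘ bounds)
  copies-bound _ m q bounds [] _ (H ∷ _) _ (c ∷ _) (H⊆[] ∷ _) with H⊆[] _ (CycleCopy.cyc-∈ {G = G} H c 0)
  ... | ()
  copies-bound k≥1 (suc m) q bounds V@(x ∷ xs) |V|≤1+m L uniq copies within
    with minimiser (λ u → degree u L) x xs
  ... | v , v∈V , v-min = begin
    ι (length L)                                  ≡⟨ cong ι (length-filter-∁ (λ H → v ∈? proj₁ H) L) ⟩
    ι (degree v L + length (avoiding v L))        ≡⟨ ι-+ (degree v L) _ ⟩
    ι (degree v L) ℚ.+ ι (length (avoiding v L))  ≤⟨ ℚ.+-mono-≤ degree≤q rest ⟩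
    q (fromℕ m) ℚ.+ sumℚ (q ∘ inject₁)            ≡⟨ ℚ.+-comm (q (fromℕ m)) _ ⟩
    sumℚ (q ∘ inject₁) ℚ.+ q (fromℕ m)            ≡⟨ sumℚ-init-last q ⟨
    sumℚ q                                        ∎
    where
      open ℚ.≤-Reasoning
      degree≤q : ι (degree v L) ≤ℚ q (fromℕ m)
      degree≤q = ≤-kth-root k (proj₁ (RootBounds-last {k} bounds)) (proj₂ (RootBounds-last {k} bounds))
        (≤-trans (min-degree-bound k≥1 uniq copies within v-min v∈V) |V|≤1+m)
      rest : ι (length (avoiding v L)) ≤ℚ sumℚ (q ∘ inject₁)
      rest = copies-bound k≥1 m (q ∘ inject₁) (RootBounds-init {k} bounds) (remove v V)
        (≤-pred (≤-trans (length-remove v∈V) |V|≤1+m)) (avoiding v L)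
        (AllPairs.filter⁺ _ uniq) (All.filter⁺ _ copies) (avoiding-within-remove v L within)

theorem26 : (k : ℕ) → 2 ≤ k → (n : ℕ) → (G : Digraph n) →
    Loopless G → KGeodetic k G →
    (L : List (SubDigraph n)) → Unique L → All (IsCopyOfCycle k G) L →
    (q : Fin n → ℚ) →
    (∀ (i : Fin n) → (0ℚ ≤ℚ q i) × ((+ suc (toℕ i) / 1) ≤ℚ powℚ (q i) k)) →
    (+ length L / 1) ≤ℚ sumℚ q
theorem26 k 2≤k n G _ geo L uniq copies q bounds =
  copies-bound geo (≤-trans (s≤s z≤n) 2≤k) n q bounds (allFin n) (≤-reflexive (length-tabulate _))
    L uniq copies (All.universal (λ _ w _ → ∈-allFin w) L)
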